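{- Let $k\ge 2$ be an integer. For arbitrarily large $n$, the quantity $1+\frac{k}{2k-2}-\frac{2}{n}$ is a lower bound on the performance guarantee of $\textsc{Contract-Cycles}_k$; that is, for arbitrarily large $n$ there is a strongly connected digraph $G$ on $n$ vertices and an execution of $\textsc{Contract-Cycles}_k$ on $G$ that returns at least $\left(1+\frac{k}{2k-2}-\frac{2}{n}\right)\mathcal{OPT}(G)$ edges.
   Context: Digraphs are finite, without self-loops or parallel edges. "Cycle" always means a simple directed cycle; a 2-cycle consists of edges $(u,v),(v,u)$. An SCSS (strongly connected spanning subgraph) of a strongly connected digraph $G$ is a subset of the edges that strongly connects all vertices of $G$; $\mathcal{OPT}(G)$ is the minimum number of edges in an SCSS of $G$. To contract a pair of vertices $u,v$ is to replace $u$ and $v$ (and each occurrence of them in any edge) by a single new vertex, and to delete any resulting self-loops and multi-edges. Each edge of the resulting graph is identified with a corresponding edge of the original graph (in the case of multi-edges, the single remaining edge is identified with any one of the corresponding original edges). To contract an edge is to contract its pair of endpoints; to contract a set of edges is to contract them in arbitrary order. Algorithm $\textsc{Contract-Cycles}_k(G)$: for $i=k,k-1,\dots,2$ in turn, while the current (contracted) graph contains a cycle with at least $i$ edges, choose any such cycle and contract its edges. Return the set of all contracted edges (identified with edges of $G$). -}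

module Defs where

open import Data.Bool using (if_then_else_)
open import Data.Fin using (Fin)
import Data.Fin as Fin
open import Data.Integer using (+_)
open import Data.List using (List; []; _∷_; _∷ʳ_; _++_; length; map; mapMaybe; zip; deduplicate)
open import Data.List.Membership.Propositional using (_∈_; _∉_)
import Data.List.Membership.DecPropositional as DecMembership
open import Data.List.Relation.Binary.Permutation.Propositional using (_↭_)
open import Data.List.Relation.Binary.Subset.Propositional using (_⊆_)
open import Data.List.Relation.Unary.All using (All)
open import Data.List.Relation.Unary.Unique.Propositional using (Unique)
open import Data.Maybe using (Maybe; just; nothing)
open import Data.Nat using (ℕ; suc; _+_; _*_; _∸_; _≤_; _<_; NonZero; NonTrivial; >-nonZero; nonTrivial⇒n>1)
open import Data.Nat.Properties using (m<n⇒0<n∸m; *-monoʳ-<)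
open import Data.Product using (_×_; _,_; ∃₂; uncurry)
import Data.Product as Product
open import Data.Product.Properties using (≡-dec)
open import Data.Rational using (ℚ; 1ℚ; _/_)
import Data.Rational as ℚ
open import Data.Sum using (_⊎_)
open import Level using (0ℓ)
open import Relation.Binary using (Rel; DecidableEquality)
open import Relation.Binary.Construct.Closure.ReflexiveTransitive using (Star)
open import Relation.Binary.PropositionalEquality using (_≡_; _≢_; cong)
open import Relation.Nullary using (does)
open import Relation.Nullary.Decidable using (dec-false)

Edge : ℕ → Set
Edge n = Fin n × Fin n

_≟ᴱ_ : ∀ {n} → DecidableEquality (Edge n)
_≟ᴱ_ = ≡-dec Fin._≟_ Fin._≟_

-- Finite sets of edges are lists of edges up to order and multiplicity;
-- hence cardinality is counted without repetitions.
card : ∀ {n} → List (Edge n) → ℕ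
card S = length (deduplicate _≟ᴱ_ S)

-- A digraph on n vertices.  Edges form a set, so there are no parallel edges.
record Digraph (n : ℕ) : Set where
  field
    edges    : List (Edge n)
    loopless : ∀ v → (v , v) ∉ edges

open Digraph public

StronglyConnects : ∀ {n} → List (Edge n) → Set
StronglyConnects S = ∀ u v → Star (λ x y → (x , y) ∈ S) u v

StronglyConnected : ∀ {n} → Digraph n → Set
StronglyConnected G = StronglyConnects (edges G)

record IsSCSS {n} (G : Digraph n) (S : List (Edge n)) : Set where
  field
    subset   : S ⊆ edges G
    connects : StronglyConnects S

-- opt = OPT(G)
record IsOPT {n} (G : Digraph n) (opt : ℕ) : Set where
  field
    {optimal} : List (Edge n)
    isSCSS    : IsSCSS G optimal
    attained  : card optimal ≡ opt
    minimal   : ∀ S → IsSCSS G S → opt ≤ card S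

-- A contracted graph with m vertices, arising from a digraph on n vertices:
-- `label H x y ≡ just e` says that (x , y) is an edge of H and is identified
-- with the original edge e; `label H x y ≡ nothing` says it is not an edge.
record Contracted (n m : ℕ) : Set where
  field
    label      : Fin m → Fin m → Maybe (Edge n)
    noSelfLoop : ∀ x → label x x ≡ nothing

open Contracted public

HasEdge : ∀ {n m} → Contracted n m → Rel (Fin m) 0ℓ
HasEdge H x y = label H x y ≢ nothing

-- The original digraph, each of whose edges is identified with itself.
initial : ∀ {n} → Digraph n → Contracted n n
initial {n} G = record
  { label      = λ x y → if does ((x , y) ∈? edges G) then just (x , y) else nothing
  ; noSelfLoop = λ x → cong (if_then just (x , x) else nothing)
                            (dec-false ((x , x) ∈? edges G) (loopless G x))
  }
  where open DecMembership (_≟ᴱ_ {n}) using (_∈?_)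

-- H′ results from H by contracting the pair of distinct vertices u, v; q sends
-- each vertex of H to the vertex of H′ replacing it.  When several edges of H
-- become parallel, `identified` lets the remaining one carry the label of any
-- of them.  Self-loops disappear because H′ has none.
record ContractsPair {n m m′} (H : Contracted n m) (u v : Fin m)
                     (q : Fin m → Fin m′) (H′ : Contracted n m′) : Set where
  field
    distinct   : u ≢ v
    onto       : ∀ a → Product.∃ λ x → q x ≡ a
    merged     : q u ≡ q v
    onlyMerged : ∀ {x y} → q x ≡ q y →
                 x ≡ y ⊎ (x ≡ u × y ≡ v) ⊎ (x ≡ v × y ≡ u)
    kept       : ∀ {x y} → HasEdge H x y → q x ≢ q y → HasEdge H′ (q x) (q y)
    identified : ∀ {a b e} → label H′ a b ≡ just e →
                 ∃₂ λ x y → q x ≡ a × q y ≡ b × label H x y ≡ just e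

-- Contracting the listed edges one after another.  After each contraction the
-- remaining edges are replaced by their images; those that have become
-- self-loops have been deleted and are skipped.
data ContractsInOrder {n} : ∀ {m m′} → Contracted n m → List (Edge m) →
                            Contracted n m′ → Set where
  done     : ∀ {m} {H : Contracted n m} → ContractsInOrder H [] H
  contract : ∀ {m m₁ m′} {H : Contracted n m} {H₁ : Contracted n m₁}
             {H′ : Contracted n m′} {u v es} {q : Fin m → Fin m₁} →
             ContractsPair H u v q H₁ →
             ContractsInOrder H₁ (map (Product.map q q) es) H′ →
             ContractsInOrder H ((u , v) ∷ es) H′
  skip     : ∀ {m m′} {H : Contracted n m} {H′ : Contracted n m′} {u es} →
             ContractsInOrder H es H′ →
             ContractsInOrder H ((u , u) ∷ es) H′

record ContractsSet {n m m′} (H : Contracted n m) (es : List (Edge m))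
                    (H′ : Contracted n m′) : Set where
  field
    {order}   : List (Edge m)
    reordered : order ↭ es
    contracts : ContractsInOrder H order H′

cycleEdges : ∀ {m} → List (Fin m) → List (Edge m)
cycleEdges []       = []
cycleEdges (x ∷ xs) = zip (x ∷ xs) (xs ∷ʳ x)

-- A simple directed cycle, given by its vertices in cyclic order; its number of
-- edges is the length of that list.
record IsCycle {n m} (H : Contracted n m) (vs : List (Fin m)) : Set where
  field
    nontrivial : 2 ≤ length vs
    simple     : Unique vs
    closed     : All (uncurry (HasEdge H)) (cycleEdges vs)

-- The original edges with which the edges of a cycle of H are identified.
originals : ∀ {n m} → Contracted n m → List (Edge m) → List (Edge n)
originals H = mapMaybe (uncurry (label H))

-- Execution i H R: the phases i, i-1, …, 2 of Contract-Cycles, started in the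
-- current graph H, may contract exactly the original edges R.
data Execution {n} : ∀ {m} → ℕ → Contracted n m → List (Edge n) → Set where
  finished  : ∀ {m} {H : Contracted n m} → Execution 1 H []
  contract  : ∀ {m m′ i} {H : Contracted n m} {H′ : Contracted n m′} {vs R} →
              IsCycle H vs → 2 + i ≤ length vs →
              ContractsSet H (cycleEdges vs) H′ →
              Execution (2 + i) H′ R →
              Execution (2 + i) H (originals H (cycleEdges vs) ++ R)
  nextPhase : ∀ {m i} {H : Contracted n m} {R} →
              (∀ vs → IsCycle H vs → length vs < 2 + i) →
              Execution (1 + i) H R →
              Execution (2 + i) H R

ContractCycles : ∀ {n} → ℕ → Digraph n → List (Edge n) → Set
ContractCycles k G R = Execution k (initial G) R

2k-2-nonZero : ∀ k → .{{NonTrivial k}} → NonZero (2 * k ∸ 2)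
2k-2-nonZero k = >-nonZero (m<n⇒0<n∸m (*-monoʳ-< 2 (nonTrivial⇒n>1 k)))

ratio : (k n : ℕ) .{{_ : NonTrivial k}} .{{n≢0 : NonZero n}} → ℚ
ratio k n = 1ℚ ℚ.+ (_/_ (+ k) (2 * k ∸ 2) {{2k-2-nonZero k}}) ℚ.- + 2 / n

{-# OPTIONS --safe #-}
module Submission where

-- Take a split graph: a clique (the core) on a(k-1) + 1 vertices and a(k-1) - 1
-- pairwise nonadjacent leaves, each joined in both directions to the whole core.
-- Inserting the leaves between consecutive core vertices gives a Hamiltonian
-- cycle, so OPT = n = 2a(k-1).
-- The algorithm may contract the core by a cycles of length k; what remains is a
-- star, whose cycles have length 2, so n - 2 further edges are contracted, and
-- ak + n - 2 = (1 + k/(2k-2) - 2/n) n.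

open import Defs
open import Data.Bool using (if_then_else_)
open import Data.Fin using (Fin; zero; suc; toℕ; fromℕ; inject₁; pinch; punchIn; _↑ˡ_; _↑ʳ_; splitAt)
import Data.Fin as Fin
open import Data.Fin.Induction using (<-weakInduction; >-weakInduction)
open import Data.Fin.Properties using (suc-injective; toℕ<n; toℕ-↑ˡ; toℕ-↑ʳ; ↑ˡ-injective; fromℕ≢inject₁; punchIn-injective; injective⇒≤; splitAt⁻¹-↑ˡ; splitAt⁻¹-↑ʳ)
open import Data.Fin.Relation.Unary.Top using (view; ‵fromℕ; ‵inject₁)
open import Data.Integer using (+_)
import Data.Integer as ℤ
import Data.Integer.Properties as ℤ
open import Data.List using (List; []; _∷_; _∷ʳ_; _++_; length; map; zip; filter; allFin; cartesianProduct; lookup; deduplicate)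
open import Data.List.Membership.Propositional using (_∈_)
import Data.List.Membership.DecPropositional as DecMembership
open import Data.List.Membership.Propositional.Properties using (∈-map⁺; ∈-map⁻; ∈-++⁺ˡ; ∈-++⁺ʳ; ∈-allFin; ∈-filter⁺; ∈-filter⁻; ∈-cartesianProduct⁺; ∈-deduplicate⁺)
open import Data.List.Properties using (length-map; length-++; length-++-sucʳ; ++-identityʳ; length-tabulate; length-zipWith; map-∘; map-++; map-id; filter-all; length-deduplicate)
open import Data.List.Relation.Binary.Disjoint.Propositional using (Disjoint)
open import Data.List.Relation.Binary.Permutation.Propositional using (↭-refl)
open import Data.List.Relation.Unary.All using (All; []; _∷_)
import Data.List.Relation.Unary.All as All
import Data.List.Relation.Unary.All.Properties as All
open import Data.List.Relation.Unary.AllPairs using ([]; _∷_)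
open import Data.List.Relation.Unary.Any using (here; there; index)
open import Data.List.Relation.Unary.Any.Properties using (lookup-index)
open import Data.List.Relation.Unary.Unique.Propositional using (Unique)
import Data.List.Relation.Unary.Unique.Propositional.Properties as Unique
open import Data.Maybe using (just; nothing)
open import Data.Nat using (ℕ; zero; suc; pred; _+_; _∸_; _≤_; _<_; z≤n; s≤s; NonZero; NonTrivial; _≤?_)
import Data.Nat as ℕ
open import Data.Nat.Properties using (≤-refl; ≤-reflexive; ≤-trans; ≤-antisym; ≤-pred; ≤⇒≯; <⇒≢; m≤m+n; m≤n+m; n≤1+n; m≤m*n; module ≤-Reasoning; +-assoc; +-identityʳ; *-identityʳ; ⊓-idem)
open import Data.Nat.Tactic.RingSolver using (solve-∀)
open import Data.Product using (Σ-syntax; ∃-syntax; _×_; _,_; proj₁; proj₂; uncurry)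
import Data.Product as Product
open import Data.Product.Properties using (,-injectiveˡ; ,-injectiveʳ)
open import Data.Rational using (ℚ; _/_; _*_) renaming (_≤_ to _≤ℚ_)
import Data.Rational as ℚ
import Data.Rational.Properties as ℚ
import Data.Rational.Unnormalised as ℚᵘ
import Data.Rational.Unnormalised.Properties as ℚᵘ
open import Data.Sum using (_⊎_; inj₁; inj₂)
open import Function using (_∘_; id; case_of_)
open import Relation.Binary.Construct.Closure.ReflexiveTransitive using (Star; ε; _◅_; _◅◅_)
import Relation.Binary.Construct.Closure.ReflexiveTransitive as Star
open import Relation.Binary.PropositionalEquality using (_≡_; _≢_; refl; sym; trans; cong; cong₂; subst; module ≡-Reasoning)
open import Relation.Nullary using (Dec; contradiction)
open import Relation.Nullary.Decidable using (dec-true; dec-false; ¬?; _×-dec_; _⊎-dec_)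

private
  variable
    A B : Set
    m n r c i : ℕ

-- Split graphs and their contractions

relabel : (Fin m → Fin n) → Edge m → Edge n
relabel f = Product.map f f

-- The vertices 0, …, c are the core.
Adjacent : ℕ → Fin m → Fin m → Set
Adjacent c x y = x ≢ y × (toℕ x ≤ c ⊎ toℕ y ≤ c)

-- `f x` is the original vertex that represents `x`. When edges become parallel, the one between
-- representatives can always be kept, so `f` alone determines the labels and hence the returned
-- edges.
record Split (f : Fin m → Fin n) (c : ℕ) (H : Contracted n m) : Set where
  field
    labelled    : ∀ {x y} → Adjacent c x y → label H x y ≡ just (f x , f y)
    independent : ∀ {x y} → c < toℕ x → c < toℕ y → label H x y ≡ nothing

  hasEdge : ∀ {x y} → Adjacent c x y → HasEdge H x y
  hasEdge adj eq = case trans (sym (labelled adj)) eq of λ ()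

open Split

-- For injective `s` this is the induced subgraph on the image of `s`. Every contraction in the
-- execution is realised in this form.
pullback : (Fin r → Fin m) → Contracted n m → Contracted n r
pullback s H = record
  { label      = λ x y → label H (s x) (s y)
  ; noSelfLoop = λ x → noSelfLoop H (s x)
  }

section₁ : Fin (suc m) → Fin (2 + m)
section₁ = punchIn (suc zero)

merge₀₁ : Fin (2 + m) → Fin (suc m)
merge₀₁ = pinch zero

-- Vertex 0 is adjacent to every other vertex, so it can represent the merged
-- pair and no labels of vertex 1 are needed.
contract₀₁ : {f : Fin (2 + m) → Fin n} {H : Contracted n (2 + m)} → Split f c H →
             ContractsPair H zero (suc zero) merge₀₁ (pullback section₁ H)
contract₀₁ {H = H} S = record
  { distinct   = λ ()
  ; onto       = λ a → section₁ a , merge-section a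
  ; merged     = refl
  ; onlyMerged = λ {x} {y} → only {x} {y}
  ; kept       = λ {x} {y} → keep x y
  ; identified = λ {a} {b} eq → section₁ a , section₁ b , merge-section a , merge-section b , eq
  }
  where
  merge-section : ∀ a → merge₀₁ (section₁ a) ≡ a
  merge-section zero    = refl
  merge-section (suc a) = refl

  only : ∀ {x y} → merge₀₁ x ≡ merge₀₁ y →
         x ≡ y ⊎ (x ≡ zero × y ≡ suc zero) ⊎ (x ≡ suc zero × y ≡ zero)
  only {zero}        {zero}        eq = inj₁ refl
  only {zero}        {suc zero}    eq = inj₂ (inj₁ (refl , refl))
  only {zero}        {suc (suc _)} ()
  only {suc zero}    {zero}        eq = inj₂ (inj₂ (refl , refl))
  only {suc (suc _)} {zero}        ()
  only {suc x}       {suc y}       eq = inj₁ (cong suc eq)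

  fromHub : ∀ {a b} → a ≢ b → toℕ (section₁ a) ≤ 0 ⊎ toℕ (section₁ b) ≤ 0 →
            HasEdge H (section₁ a) (section₁ b)
  fromHub a≢b (inj₁ a≤0) = hasEdge S (a≢b ∘ punchIn-injective _ _ _ , inj₁ (≤-trans a≤0 z≤n))
  fromHub a≢b (inj₂ b≤0) = hasEdge S (a≢b ∘ punchIn-injective _ _ _ , inj₂ (≤-trans b≤0 z≤n))

  keep : ∀ x y → HasEdge H x y → merge₀₁ x ≢ merge₀₁ y →
         HasEdge H (section₁ (merge₀₁ x)) (section₁ (merge₀₁ y))
  keep zero          y             _ x≢y = fromHub x≢y (inj₁ z≤n)
  keep (suc zero)    y             _ x≢y = fromHub x≢y (inj₁ z≤n)
  keep (suc (suc x)) zero          _ x≢y = fromHub x≢y (inj₂ z≤n)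
  keep (suc (suc x)) (suc zero)    _ x≢y = fromHub x≢y (inj₂ z≤n)
  keep (suc (suc x)) (suc (suc y)) e _   = e

-- While `c` is positive, merging 0 and 1 uses up one core vertex. Once `c` is 0 the graph is a
-- star, vertex 1 is a leaf absorbed by the centre, and `pred 0 ≡ 0` records that a star remains.
split-pullback : {f : Fin (2 + m) → Fin n} {H : Contracted n (2 + m)} →
                 Split f c H → Split (f ∘ section₁) (pred c) (pullback section₁ H)
split-pullback {m = m} {c = c} S = record
  { labelled    = λ {x} {y} → λ where
      (x≢y , inj₁ x≤c) → labelled S (x≢y ∘ punchIn-injective _ _ _ , inj₁ (core c x x≤c))
      (x≢y , inj₂ y≤c) → labelled S (x≢y ∘ punchIn-injective _ _ _ , inj₂ (core c y y≤c))
  ; independent = λ {x} {y} c<x c<y → independent S (leaf c x c<x) (leaf c y c<y)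
  }
  where
  core : ∀ c (x : Fin (suc m)) → toℕ x ≤ pred c → toℕ (section₁ x) ≤ c
  core c       zero    _   = z≤n
  core (suc c) (suc x) x≤c = s≤s x≤c

  leaf : ∀ c (x : Fin (suc m)) → pred c < toℕ x → c < toℕ (section₁ x)
  leaf zero    (suc x) _   = s≤s z≤n
  leaf (suc c) (suc x) c<x = s≤s c<x

-- The short cycle 0 → 1 → … → j → 0

-- The vertices 1, ..., j. Building them by shifting suits `merge₀₁`, which cancels `suc`.
path : ∀ j → List (Fin (suc (j + r)))
path zero    = []
path (suc j) = map suc (zero ∷ path j)

cycle : ∀ j → List (Fin (suc (j + r)))
cycle j = zero ∷ path j

section : ∀ j → Fin (suc r) → Fin (suc (j + r))
section zero    = id
section (suc j) = section₁ ∘ section j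

-- Contracting the edge from 0 to 1 turns the remaining edges, in order, into those of the next
-- shorter cycle.
contractCycle : ∀ j {f : Fin (suc (j + r)) → Fin n} {H : Contracted n (suc (j + r))} →
                Split f c H → ContractsInOrder H (cycleEdges (cycle j)) (pullback (section j) H)
-- By now the closing edge has become the self-loop at 0.
contractCycle zero    S = skip done
contractCycle (suc j) {H = H} S =
  contract (contract₀₁ S)
    (subst (λ es → ContractsInOrder (pullback section₁ H) es (pullback (section (suc j)) H)) (sym (merged-zip (cycle j) (path j)))
      (contractCycle j (split-pullback S)))
  where
  merged-zip : ∀ (xs ys : List (Fin (suc m))) →
               map (relabel merge₀₁) (zip (map suc xs) (map suc ys ∷ʳ zero)) ≡ zip xs (ys ∷ʳ zero)
  merged-zip []           ys       = refl
  merged-zip (x ∷ [])     []       = refl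
  merged-zip (x ∷ _ ∷ _)  []       = refl
  merged-zip (x ∷ xs)     (y ∷ ys) = cong ((x , y) ∷_) (merged-zip xs ys)

cycle-unique : ∀ j → Unique (cycle {r} j)
cycle-unique zero    = [] ∷ []
cycle-unique (suc j) =
  All.map⁺ (All.universal (λ _ ()) _) ∷ Unique.map⁺ suc-injective (cycle-unique j)

cycle-bounded : ∀ j → All (λ x → toℕ x ≤ j) (cycle {r} j)
cycle-bounded zero    = z≤n ∷ []
cycle-bounded (suc j) = z≤n ∷ All.map⁺ (All.map s≤s (cycle-bounded j))

length-cycle : ∀ j → length (cycle {r} j) ≡ suc j
length-cycle zero    = refl
length-cycle (suc j) = cong suc (trans (length-map suc (cycle j)) (length-cycle j))

zip-all : {P : A → Set} {Q : B → Set} {xs : List A} {ys : List B} → All P xs → All Q ys →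
          All (λ e → P (proj₁ e) × Q (proj₂ e)) (zip xs ys)
zip-all []         _          = []
zip-all (_ ∷ _)    []         = []
zip-all (px ∷ pxs) (qy ∷ qys) = (px , qy) ∷ zip-all pxs qys

zip-unique : {xs : List A} (ys : List B) → Unique xs → Unique (zip xs ys)
zip-unique _        []         = []
zip-unique []       (_ ∷ _)    = []
zip-unique (y ∷ ys) (x≢xs ∷ u) =
  All.map (λ (x≢ , _) → x≢ ∘ ,-injectiveˡ) (zip-all x≢xs (All.universal (λ _ → refl {x = y}) ys))
  ∷ zip-unique ys u

cycleEdges-unique : {xs : List (Fin m)} → Unique xs → Unique (cycleEdges xs)
cycleEdges-unique []        = []
cycleEdges-unique u@(_ ∷ _) = zip-unique _ u

cycleEdges-loopless : {xs : List (Fin m)} → 2 ≤ length xs → Unique xs →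
                      All (uncurry _≢_) (cycleEdges xs)
cycleEdges-loopless {xs = _ ∷ []}     (s≤s ())
cycleEdges-loopless {xs = x ∷ y ∷ ys} _ ((x≢y ∷ x≢ys) ∷ u) = x≢y ∷ rest u (x≢y ∷ x≢ys)
  where
  -- `x` is the first vertex of the cycle, carried along for the closing edge.
  rest : ∀ {y ys x} → Unique (y ∷ ys) → All (x ≢_) (y ∷ ys) →
         All (uncurry _≢_) (zip (y ∷ ys) (ys ∷ʳ x))
  rest {ys = []}    _               (x≢y ∷ []) = (x≢y ∘ sym) ∷ []
  rest {ys = _ ∷ _} ((y≢z ∷ _) ∷ u) (_ ∷ x≢)   = y≢z ∷ rest u x≢

length-cycleEdges : (xs : List (Fin m)) → length (cycleEdges xs) ≡ length xs
length-cycleEdges []       = refl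
length-cycleEdges (x ∷ xs) = begin
  length (zip (x ∷ xs) (xs ∷ʳ x))       ≡⟨ length-zipWith _,_ (x ∷ xs) (xs ∷ʳ x) ⟩
  suc (length xs) ℕ.⊓ length (xs ∷ʳ x)  ≡⟨ cong (suc (length xs) ℕ.⊓_) (trans (length-++-sucʳ xs x []) (cong (suc ∘ length) (++-identityʳ xs))) ⟩
  suc (length xs) ℕ.⊓ suc (length xs)   ≡⟨ ⊓-idem _ ⟩
  suc (length xs)                       ∎
  where open ≡-Reasoning

shortEdges : ∀ j → List (Edge (suc (j + r)))
shortEdges j = cycleEdges (cycle j)

shortEdges-loopless : ∀ j → All (uncurry _≢_) (shortEdges {r} (suc j))
shortEdges-loopless j =
  cycleEdges-loopless (≤-trans (s≤s (s≤s z≤n)) (≤-reflexive (sym (length-cycle (suc j)))))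
                      (cycle-unique (suc j))

shortEdges-bounded : ∀ j → All (λ e → toℕ (proj₁ e) ≤ j × toℕ (proj₂ e) ≤ j) (shortEdges {r} j)
shortEdges-bounded j =
  zip-all (cycle-bounded j) (All.++⁺ (All.tail (cycle-bounded j)) (z≤n ∷ []))

-- The edges returned

-- One less than a number of vertices, or the index of the last core vertex: contracting a cycle of
-- length `j + 1` lowers either by `j`. The recursion makes the `Fin` indices of successive graphs
-- agree by computation, which `a * j + r` would not.
vertices : ℕ → ℕ → ℕ → ℕ
vertices j zero    r = r
vertices j (suc a) r = j + vertices j a r

vertices≡ : ∀ j a r → vertices j a r ≡ a ℕ.* j + r
vertices≡ j zero    r = refl
vertices≡ j (suc a) r = trans (cong (λ s → j + s) (vertices≡ j a r)) (sym (+-assoc j (a ℕ.* j) r))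

-- Contract the short cycle of length j + 1 and rename the remaining vertices to
-- an initial segment, a times; R is what is contracted afterwards.
contracted : ∀ j a → List (Edge (suc r)) → List (Edge (suc (vertices j a r)))
contracted j zero    R = R
contracted j (suc a) R = shortEdges j ++ map (relabel (section j)) (contracted j a R)

length-contracted : ∀ j a (R : List (Edge (suc r))) →
                    length (contracted j a R) ≡ a ℕ.* suc j + length R
length-contracted j zero    R = refl
length-contracted j (suc a) R = begin
  length (shortEdges j ++ map (relabel (section j)) (contracted j a R))
    ≡⟨ length-++ (shortEdges j) ⟩
  length (shortEdges j) + length (map (relabel (section j)) (contracted j a R))
    ≡⟨ cong₂ _+_ (trans (length-cycleEdges (cycle j)) (length-cycle j))
                 (trans (length-map _ (contracted j a R)) (length-contracted j a R)) ⟩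
  suc j + (a ℕ.* suc j + length R)
    ≡⟨ +-assoc (suc j) (a ℕ.* suc j) (length R) ⟨
  suc j + a ℕ.* suc j + length R ∎
  where open ≡-Reasoning

section-injective : ∀ j {x y : Fin (suc r)} → section j x ≡ section j y → x ≡ y
section-injective zero    eq = eq
section-injective (suc j) eq = section-injective j (punchIn-injective _ _ _ eq)

-- `section j` fixes 0 and skips 1, ..., j. Hence later edges meet the short cycle in vertex 0 only.
section-bounded : ∀ j (x : Fin (suc r)) → toℕ (section j x) ≤ j → x ≡ zero
section-bounded zero    zero _   = refl
section-bounded (suc j) x    x≤j = section-bounded j x (section₁-bounded (section j x) x≤j)
  where
  section₁-bounded : (x : Fin (suc m)) → toℕ (section₁ x) ≤ suc i → toℕ x ≤ i
  section₁-bounded zero    _   = z≤n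
  section₁-bounded (suc x) x≤i = ≤-pred x≤i

-- A later edge that is also an edge of the short cycle would have both ends at 0, but a cycle of
-- length at least 2 has no loops. This lets `length` replace `card` for the returned edges.
contracted-unique : ∀ j a {R : List (Edge (suc r))} → Unique R → Unique (contracted (suc j) a R)
contracted-unique j zero    u = u
contracted-unique j (suc a) {R} u =
  Unique.++⁺ (cycleEdges-unique (cycle-unique (suc j)))
             (Unique.map⁺ (λ eq → cong₂ _,_ (section-injective (suc j) (,-injectiveˡ eq))
                                            (section-injective (suc j) (,-injectiveʳ eq)))
                          (contracted-unique j a u))
             disjoint
  where
  disjoint : Disjoint (shortEdges (suc j)) (map (relabel (section (suc j))) (contracted (suc j) a R))
  disjoint (e∈short , e∈rest) with ∈-map⁻ (relabel (section (suc j))) e∈rest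
  ... | (x , y) , _ , refl =
    let x≤j , y≤j = All.lookup (shortEdges-bounded (suc j)) e∈short
        x≡y = trans (section-bounded (suc j) x x≤j) (sym (section-bounded (suc j) y y≤j))
    in All.lookup (shortEdges-loopless j) e∈short (cong (section (suc j)) x≡y)

-- The execution

split-section : ∀ j {f : Fin (suc (j + r)) → Fin n} {H : Contracted n (suc (j + r))} →
             Split f (j + c) H → Split (f ∘ section j) c (pullback (section j) H)
split-section zero    S = S
split-section (suc j) S = split-section j (split-pullback S)

originals-split : {f : Fin m → Fin n} {H : Contracted n m} → Split f c H →
                  {es : List (Edge m)} → All (uncurry (Adjacent c)) es →
                  originals H es ≡ map (relabel f) es
originals-split S []           = refl
originals-split S (adj ∷ adjs) rewrite labelled S adj = cong (_ ∷_) (originals-split S adjs)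

-- Shared by both phases, hence the adjacency hypothesis: in the core phase the whole cycle lies in
-- the core, in the star phase only its vertex 0 does.
contractShort : ∀ j {f : Fin (suc (suc j + r)) → Fin n} {H : Contracted n (suc (suc j + r))} →
                Split f c H → All (uncurry (Adjacent c)) (shortEdges (suc j)) → i ≤ j →
                {R : List (Edge (suc r))} →
                Execution (2 + i) (pullback (section (suc j)) H) (map (relabel (f ∘ section (suc j))) R) →
                Execution (2 + i) H
                  (map (relabel f) (shortEdges (suc j) ++ map (relabel (section (suc j))) R))
contractShort j {f} {H} S adj i≤j {R} ex =
  subst (Execution _ H) (sym returned)
    (contract isCycle (≤-trans (s≤s (s≤s i≤j)) 2+j≤)
      (record { reordered = ↭-refl ; contracts = contractCycle (suc j) S }) ex)
  where
  2+j≤ : 2 + j ≤ length (cycle (suc j))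
  2+j≤ = ≤-reflexive (sym (length-cycle (suc j)))

  isCycle : IsCycle H (cycle (suc j))
  isCycle = record
    { nontrivial = ≤-trans (s≤s (s≤s z≤n)) 2+j≤
    ; simple     = cycle-unique (suc j)
    ; closed     = All.map (hasEdge S) adj
    }

  returned : map (relabel f) (shortEdges (suc j) ++ map (relabel (section (suc j))) R) ≡
             originals H (shortEdges (suc j)) ++ map (relabel (f ∘ section (suc j))) R
  returned = trans (map-++ (relabel f) (shortEdges (suc j)) _)
                   (cong₂ _++_ (sym (originals-split S adj)) (sym (map-∘ R)))

-- The continuation is quantified over `g` and `H′` because the graph left at the end is only
-- produced by the recursion.
corePhase : ∀ j a {f : Fin (suc (vertices (suc j) a r)) → Fin n}
            {H : Contracted n (suc (vertices (suc j) a r))} {R : List (Edge (suc r))} →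
            (∀ {g : Fin (suc r) → Fin n} {H′} → Split g c H′ → Execution (2 + j) H′ (map (relabel g) R)) →
            Split f (vertices (suc j) a c) H →
            Execution (2 + j) H (map (relabel f) (contracted (suc j) a R))
corePhase j zero    continue S = continue S
corePhase j (suc a) continue S =
  contractShort j S (All.zipWith (λ (x≢y , x≤j , _) → x≢y , inj₁ (≤-trans x≤j (m≤m+n _ _)))
                                 (shortEdges-loopless j , shortEdges-bounded (suc j)))
    ≤-refl (corePhase j a continue (split-section (suc j) S))

starPhase : ∀ l {f : Fin (suc (vertices 1 l 0)) → Fin n} {H : Contracted n (suc (vertices 1 l 0))} →
            Split f 0 H → Execution 2 H (map (relabel f) (contracted 1 l []))
starPhase zero    S = nextPhase noCycle finished
  where
  noCycle : ∀ {H : Contracted n 1} vs → IsCycle H vs → length vs < 2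
  noCycle []                _ = s≤s z≤n
  noCycle (_ ∷ [])          _ = s≤s (s≤s z≤n)
  noCycle (zero ∷ zero ∷ _) C with IsCycle.simple C
  ... | (0≢0 ∷ _) ∷ _ = contradiction refl 0≢0
starPhase (suc l) S =
  -- The 2-cycle between the centre 0 and the leaf 1.
  contractShort 0 S (((λ ()) , inj₁ z≤n) ∷ ((λ ()) , inj₂ z≤n) ∷ []) z≤n
    (starPhase l (split-pullback S))

star-edge : {f : Fin (suc m) → Fin n} {H : Contracted n (suc m)} → Split f 0 H →
            ∀ {x y} → HasEdge H x y → x ≡ zero ⊎ y ≡ zero
star-edge S {zero}          _ = inj₁ refl
star-edge S {suc _} {zero}  _ = inj₂ refl
star-edge S {suc _} {suc _} e = contradiction (independent S (s≤s z≤n) (s≤s z≤n)) e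

-- Every edge meets the centre. On a longer cycle the first two edges force `y` to be the centre,
-- and then the edge leaving `z` avoids it.
star-cycle : {f : Fin (suc m) → Fin n} {H : Contracted n (suc m)} → Split f 0 H →
             ∀ vs → IsCycle H vs → length vs < 3
star-cycle S []           _ = s≤s z≤n
star-cycle S (_ ∷ [])     _ = s≤s (s≤s z≤n)
star-cycle S (_ ∷ _ ∷ []) _ = s≤s (s≤s (s≤s z≤n))
star-cycle S (x ∷ y ∷ z ∷ ws) C with IsCycle.simple C | IsCycle.closed C
... | (x≢y ∷ x≢z ∷ _) ∷ (y≢z ∷ y≢ws) ∷ _ | xy ∷ yz ∷ more
  with star-edge S xy | star-edge S yz
... | inj₁ refl | inj₁ refl = contradiction refl x≢y
... | inj₁ refl | inj₂ refl = contradiction refl x≢z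
... | inj₂ refl | inj₂ refl = contradiction refl y≢z
... | inj₂ refl | inj₁ refl with ws | y≢ws | more
...   | []    | _       | zx ∷ _ = case star-edge S zx of λ where
                                     (inj₁ refl) → contradiction refl y≢z
                                     (inj₂ refl) → contradiction refl x≢y
...   | _ ∷ _ | y≢w ∷ _ | zw ∷ _ = case star-edge S zw of λ where
                                     (inj₁ refl) → contradiction refl y≢z
                                     (inj₂ refl) → contradiction refl y≢w

-- A star has no cycle with 3 or more edges, so nothing happens before phase 2.
skipPhases : ∀ i {f : Fin (suc m) → Fin n} {H : Contracted n (suc m)} {R : List (Edge n)} →
             Split f 0 H → Execution 2 H R → Execution (2 + i) H R
skipPhases zero    S ex = ex
skipPhases (suc i) S ex =
  nextPhase (λ vs C → ≤-trans (star-cycle S vs C) (s≤s (s≤s (s≤s z≤n)))) (skipPhases i S ex)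

-- The split graph and its optimum

adjacent? : ∀ c (e : Edge m) → Dec (uncurry (Adjacent c) e)
adjacent? c (x , y) = ¬? (x Fin.≟ y) ×-dec (toℕ x ≤? c ⊎-dec toℕ y ≤? c)

splitGraph : ℕ → ∀ m → Digraph m
splitGraph c m = record
  { edges    = filter (adjacent? c) (cartesianProduct (allFin m) (allFin m))
  ; loopless = λ v v∈ → proj₁ (proj₂ (∈-filter⁻ (adjacent? c) {xs = cartesianProduct (allFin m) (allFin m)} v∈)) refl
  }

adjacent⇒∈ : {x y : Fin m} → Adjacent c x y → (x , y) ∈ edges (splitGraph c m)
adjacent⇒∈ {c = c} adj =
  ∈-filter⁺ (adjacent? c) (∈-cartesianProduct⁺ (∈-allFin _) (∈-allFin _)) adj

initial-split : Split id c (initial (splitGraph c m))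
initial-split {c = c} {m = m} = record
  { labelled    = λ adj → cong (if_then just _ else nothing)
                               (dec-true (_ ∈? edges (splitGraph c m)) (adjacent⇒∈ adj))
  ; independent = λ {x} {y} c<x c<y → cong (if_then just (x , y) else nothing)
      (dec-false ((x , y) ∈? edges (splitGraph c m)) λ e∈ →
        case proj₂ (proj₂ (∈-filter⁻ (adjacent? c) {xs = cartesianProduct (allFin m) (allFin m)} e∈)) of λ where
          (inj₁ x≤c) → ≤⇒≯ x≤c c<x
          (inj₂ y≤c) → ≤⇒≯ y≤c c<y)
  }
  where open DecMembership (_≟ᴱ_ {m}) using (_∈?_)

outEdge : {S : List (Edge (2 + n))} → StronglyConnects S → ∀ v → ∃[ w ] (v , w) ∈ S
outEdge connects zero with connects zero (suc zero)
... | e∈S ◅ _ = _ , e∈S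
outEdge connects (suc v) with connects (suc v) zero
... | e∈S ◅ _ = _ , e∈S

-- Every vertex has an outgoing edge in `S`, and edges with different sources occupy different
-- positions.
n≤card : (S : List (Edge (2 + n))) → StronglyConnects S → 2 + n ≤ card S
n≤card {n} S connects = injective⇒≤ {f = position} λ {u} {v} eq →
  trans (cong proj₁ (at-position u))
        (trans (cong (proj₁ ∘ lookup (deduplicate _≟ᴱ_ S)) eq) (sym (cong proj₁ (at-position v))))
  where
  out∈ : ∀ v → (v , proj₁ (outEdge connects v)) ∈ deduplicate _≟ᴱ_ S
  out∈ v = ∈-deduplicate⁺ _≟ᴱ_ (proj₂ (outEdge connects v))

  position : Fin (2 + n) → Fin (card S)
  position v = index (out∈ v)

  at-position : ∀ v → (v , proj₁ (outEdge connects v)) ≡ lookup (deduplicate _≟ᴱ_ S) (position v)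
  at-position v = lookup-index (out∈ v)

-- The cycle alternates core 0, leaf 0, core 1, leaf 1, ..., core l. There are two more core
-- vertices than leaves, so it closes with two edges inside the core, through core l + 1 and back to
-- core 0.
module Hamiltonian (l : ℕ) where

  n′ : ℕ
  n′ = 2 + l + l

  core : Fin (2 + l) → Fin n′
  core x = x ↑ˡ l

  leaf : Fin l → Fin n′
  leaf y = (2 + l) ↑ʳ y

  last : Fin (2 + l)
  last = fromℕ (suc l)

  toLeaf fromLeaf : Fin l → Edge n′
  -- The embeddings have the shape of the steps of weak induction on `Fin (suc l)`, from `inject₁ y`
  -- to `suc y`, under one further `inject₁`.
  toLeaf   y = core (inject₁ (inject₁ y)) , leaf y
  fromLeaf y = leaf y , core (inject₁ (suc y))

  closing : List (Edge n′)
  closing = (core (inject₁ (fromℕ l)) , core last) ∷ (core last , core zero) ∷ []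

  hamiltonian : List (Edge n′)
  hamiltonian = map toLeaf (allFin l) ++ map fromLeaf (allFin l) ++ closing

  length-hamiltonian : length hamiltonian ≡ n′
  length-hamiltonian = begin
    length hamiltonian
      ≡⟨ length-++ (map toLeaf (allFin l)) ⟩
    length (map toLeaf (allFin l)) + length (map fromLeaf (allFin l) ++ closing)
      ≡⟨ cong₂ _+_ (length-images toLeaf)
           (trans (length-++ (map fromLeaf (allFin l))) (cong (_+ 2) (length-images fromLeaf))) ⟩
    l + (l + 2)
      ≡⟨ rearrange l ⟩
    n′ ∎
    where
    open ≡-Reasoning
    length-images : (e : Fin l → Edge n′) → length (map e (allFin l)) ≡ l
    length-images e = trans (length-map e (allFin l)) (length-tabulate id)

    rearrange : ∀ l → l + (l + 2) ≡ 2 + l + l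
    rearrange = solve-∀

  core≤ : ∀ x → toℕ (core x) ≤ suc l
  core≤ x = ≤-trans (≤-reflexive (toℕ-↑ˡ x l)) (≤-pred (toℕ<n x))

  core≢leaf : ∀ x y → core x ≢ leaf y
  core≢leaf x y eq = <⇒≢ (≤-trans (s≤s (core≤ x)) (≤-trans (m≤m+n _ (toℕ y)) (≤-reflexive (sym (toℕ-↑ʳ (2 + l) y)))))
                        (cong toℕ eq)

  adjacent : All (uncurry (Adjacent (suc l))) hamiltonian
  adjacent =
    All.++⁺ (All.map⁺ (All.universal (λ y → core≢leaf _ y , inj₁ (core≤ _)) (allFin l)))
    (All.++⁺ (All.map⁺ (All.universal (λ y → core≢leaf _ y ∘ sym , inj₂ (core≤ _)) (allFin l)))
    (((fromℕ≢inject₁ ∘ sym ∘ ↑ˡ-injective l _ _) , inj₁ (core≤ _)) ∷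
     ((λ ()) , inj₁ (core≤ _)) ∷ []))

  _⟶*_ : Fin n′ → Fin n′ → Set
  _⟶*_ = Star (λ x y → (x , y) ∈ hamiltonian)

  toLeaf∈ : ∀ y → toLeaf y ∈ hamiltonian
  toLeaf∈ y = ∈-++⁺ˡ (∈-map⁺ toLeaf (∈-allFin y))

  fromLeaf∈ : ∀ y → fromLeaf y ∈ hamiltonian
  fromLeaf∈ y = ∈-++⁺ʳ (map toLeaf (allFin l)) (∈-++⁺ˡ (∈-map⁺ fromLeaf (∈-allFin y)))

  closing∈ : ∀ {e} → e ∈ closing → e ∈ hamiltonian
  closing∈ = ∈-++⁺ʳ (map toLeaf (allFin l)) ∘ ∈-++⁺ʳ (map fromLeaf (allFin l))

  fromZero : ∀ z → core zero ⟶* core (inject₁ z)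
  fromZero = <-weakInduction (λ z → core zero ⟶* core (inject₁ z)) ε
    (λ y walk → walk ◅◅ toLeaf∈ y ◅ fromLeaf∈ y ◅ ε)

  toZero : ∀ z → core (inject₁ z) ⟶* core zero
  toZero = >-weakInduction (λ z → core (inject₁ z) ⟶* core zero)
    (closing∈ (here refl) ◅ closing∈ (there (here refl)) ◅ ε)
    (λ y walk → toLeaf∈ y ◅ fromLeaf∈ y ◅ walk)

  ThroughZero : Fin n′ → Set
  ThroughZero v = core zero ⟶* v × v ⟶* core zero

  throughZero-leaf : ∀ y → ThroughZero (leaf y)
  throughZero-leaf y = fromZero (inject₁ y) ◅◅ toLeaf∈ y ◅ ε , fromLeaf∈ y ◅ toZero (suc y)

  throughZero-core : ∀ x → ThroughZero (core x)
  throughZero-core x with view x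
  ... | ‵inject₁ z = fromZero z , toZero z
  ... | ‵fromℕ     = fromZero (fromℕ l) ◅◅ closing∈ (here refl) ◅ ε
                   , closing∈ (there (here refl)) ◅ ε

  throughZero : ∀ v → ThroughZero v
  throughZero v with splitAt (2 + l) v in eq
  ... | inj₁ x = subst ThroughZero (splitAt⁻¹-↑ˡ eq) (throughZero-core x)
  ... | inj₂ y = subst ThroughZero (splitAt⁻¹-↑ʳ eq) (throughZero-leaf y)

  isOPT : IsOPT (splitGraph (suc l) n′) n′
  isOPT = record
    { optimal  = hamiltonian
    ; isSCSS   = record { subset = adjacent⇒∈ ∘ All.lookup adjacent ; connects = connects }
    -- Deduplication cannot exceed the length `n′`, and strong connectivity forces at least `n′`
    -- edges; together they give the cardinality without comparing edges.
    ; attained = ≤-antisym (≤-trans (length-deduplicate _≟ᴱ_ hamiltonian) (≤-reflexive length-hamiltonian))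
                           (n≤card hamiltonian connects)
    ; minimal  = λ S scss → n≤card S (IsSCSS.connects scss)
    }
    where
    connects : StronglyConnects hamiltonian
    connects u v = proj₂ (throughZero u) ◅◅ proj₁ (throughZero v)

optimum⇒stronglyConnected : {G : Digraph n} {opt : ℕ} → IsOPT G opt → StronglyConnected G
optimum⇒stronglyConnected O u v = Star.map (IsSCSS.subset scss) (IsSCSS.connects scss u v)
  where scss = IsOPT.isSCSS O

card-unique : {S : List (Edge n)} → Unique S → card S ≡ length S
card-unique = cong length ∘ deduplicate-unique
  where
  deduplicate-unique : {S : List (Edge n)} → Unique S → deduplicate _≟ᴱ_ S ≡ S
  deduplicate-unique []                     = refl
  deduplicate-unique {S = x ∷ _} (x≢S ∷ u)  =
    cong (x ∷_) (trans (cong (filter (¬? ∘ (x ≟ᴱ_))) (deduplicate-unique u))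
                       (filter-all (¬? ∘ (x ≟ᴱ_)) x≢S))

-- The ratio

-- Passing to unnormalised rationals reduces the claim to cross-multiplication.
/-*-scale : ∀ p d n q .{{_ : NonZero d}} → p ℕ.* n ≡ q ℕ.* d → (+ p / d) * (+ n / 1) ≡ + q / 1
/-*-scale p d@(suc d-1) n q eq = ℚ.toℚᵘ-injective (begin
  ℚ.toℚᵘ ((+ p / d) * (+ n / 1))            ≈⟨ ℚ.toℚᵘ-homo-* (+ p / d) (+ n / 1) ⟩
  ℚ.toℚᵘ (+ p / d) ℚᵘ.* ℚ.toℚᵘ (+ n / 1)    ≈⟨ ℚᵘ.*-cong (ℚ.toℚᵘ-fromℚᵘ (ℚᵘ.mkℚᵘ (+ p) d-1)) (ℚ.toℚᵘ-fromℚᵘ (ℚᵘ.mkℚᵘ (+ n) 0)) ⟩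
  ℚᵘ.mkℚᵘ (+ p) d-1 ℚᵘ.* ℚᵘ.mkℚᵘ (+ n) 0    ≈⟨ ℚᵘ.*≡* scaled ⟩
  ℚᵘ.mkℚᵘ (+ q) 0                           ≈⟨ ℚ.toℚᵘ-fromℚᵘ (ℚᵘ.mkℚᵘ (+ q) 0) ⟨
  ℚ.toℚᵘ (+ q / 1)                          ∎)
  where
  open ℚᵘ.≃-Reasoning
  scaled : (+ p ℤ.* + n) ℤ.* + 1 ≡ + q ℤ.* + (d ℕ.* 1)
  scaled = trans (ℤ.*-identityʳ (+ p ℤ.* + n))
          (trans (sym (ℤ.pos-* p n))
          (trans (cong +_ (trans eq (cong (λ t → q ℕ.* t) (sym (*-identityʳ d)))))
                 (ℤ.pos-* q (d ℕ.* 1))))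

/1-homo-+ : ∀ p q → (+ p / 1) ℚ.+ (+ q / 1) ≡ + (p + q) / 1
/1-homo-+ p q = ℚ.toℚᵘ-injective (begin
  ℚ.toℚᵘ ((+ p / 1) ℚ.+ (+ q / 1))          ≈⟨ ℚ.toℚᵘ-homo-+ (+ p / 1) (+ q / 1) ⟩
  ℚ.toℚᵘ (+ p / 1) ℚᵘ.+ ℚ.toℚᵘ (+ q / 1)    ≈⟨ ℚᵘ.+-cong (ℚ.toℚᵘ-fromℚᵘ (ℚᵘ.mkℚᵘ (+ p) 0)) (ℚ.toℚᵘ-fromℚᵘ (ℚᵘ.mkℚᵘ (+ q) 0)) ⟩
  ℚᵘ.mkℚᵘ (+ p) 0 ℚᵘ.+ ℚᵘ.mkℚᵘ (+ q) 0      ≈⟨ ℚᵘ.*≡* (cong (ℤ._* + 1) (cong₂ ℤ._+_ (ℤ.*-identityʳ (+ p)) (ℤ.*-identityʳ (+ q)))) ⟩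
  ℚᵘ.mkℚᵘ (+ (p + q)) 0                     ≈⟨ ℚ.toℚᵘ-fromℚᵘ (ℚᵘ.mkℚᵘ (+ (p + q)) 0) ⟨
  ℚ.toℚᵘ (+ (p + q) / 1)                    ∎)
  where open ℚᵘ.≃-Reasoning

-- With `a` core cycles, the term `k / (2k - 2)` scales to `a * k` and `2 / n` to 2. The count `q`
-- enters through `q + 2` to avoid natural subtraction.
ratio-* : ∀ k n a q .{{_ : NonTrivial k}} .{{n≢0 : NonZero n}} →
          n ≡ a ℕ.* (2 ℕ.* k ∸ 2) → n + a ℕ.* k ≡ q + 2 →
          ratio k n * (+ n / 1) ≡ + q / 1
ratio-* k n a q n≡ sum≡ = begin
  (ℚ.1ℚ ℚ.+ k/2k-2 ℚ.- + 2 / n) * N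
    ≡⟨ ℚ.*-distribʳ-+ N (ℚ.1ℚ ℚ.+ k/2k-2) (ℚ.- (+ 2 / n)) ⟩
  (ℚ.1ℚ ℚ.+ k/2k-2) * N ℚ.+ (ℚ.- (+ 2 / n)) * N
    ≡⟨ cong₂ ℚ._+_ (ℚ.*-distribʳ-+ N ℚ.1ℚ k/2k-2) (sym (ℚ.neg-distribˡ-* (+ 2 / n) N)) ⟩
  ℚ.1ℚ * N ℚ.+ k/2k-2 * N ℚ.- (+ 2 / n) * N
    ≡⟨ cong₂ ℚ._-_
         (cong₂ ℚ._+_ (ℚ.*-identityˡ N) (/-*-scale k (2 ℕ.* k ∸ 2) n (a ℕ.* k) {{2k-2-nonZero k}} scaled))
         (/-*-scale 2 n n 2 refl) ⟩
  N ℚ.+ (+ (a ℕ.* k) / 1) ℚ.- + 2 / 1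
    ≡⟨ cong (ℚ._- + 2 / 1) (trans (/1-homo-+ n (a ℕ.* k))
         (trans (cong (λ s → + s / 1) sum≡) (sym (/1-homo-+ q 2)))) ⟩
  (+ q / 1 ℚ.+ + 2 / 1) ℚ.- + 2 / 1
    ≡⟨ ℚ.+-assoc (+ q / 1) (+ 2 / 1) (ℚ.- (+ 2 / 1)) ⟩
  + q / 1 ℚ.+ (+ 2 / 1 ℚ.- + 2 / 1)
    ≡⟨ cong (λ t → + q / 1 ℚ.+ t) (ℚ.+-inverseʳ (+ 2 / 1)) ⟩
  + q / 1 ℚ.+ ℚ.0ℚ
    ≡⟨ ℚ.+-identityʳ (+ q / 1) ⟩
  + q / 1 ∎
  where
  open ≡-Reasoning
  N k/2k-2 : ℚ
  N      = + n / 1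
  k/2k-2 = _/_ (+ k) (2 ℕ.* k ∸ 2) {{2k-2-nonZero k}}

  rearrange : ∀ k a d → k ℕ.* (a ℕ.* d) ≡ a ℕ.* k ℕ.* d
  rearrange = solve-∀

  scaled : k ℕ.* n ≡ a ℕ.* k ℕ.* (2 ℕ.* k ∸ 2)
  scaled = trans (cong (λ t → k ℕ.* t) n≡) (rearrange k a (2 ℕ.* k ∸ 2))

-- Choice of the parameters for given `k` and `N`

mainTheorem7 : (k : ℕ) .{{_ : NonTrivial k}} (N : ℕ) →
    ∃[ n ] Σ[ n≢0 ∈ NonZero n ] N ≤ n ×
    Σ[ G ∈ Digraph n ] StronglyConnected G ×
    Σ[ R ∈ List (Edge n) ] ContractCycles k G R ×
    ∃[ opt ] IsOPT G opt ×
    ratio k n {{n≢0 = n≢0}} * (+ opt / 1) ≤ℚ + card R / 1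
mainTheorem7 k@(suc (suc κ)) N =
  suc M , _ , N≤n , G , optimum⇒stronglyConnected isOPT ,
  R , subst (Execution k (initial G)) (map-id R) execution ,
  suc M , isOPT ,
  ℚ.≤-reflexive (trans (ratio-* k (suc M) a (length R) n≡ sum≡)
                       (cong (λ s → + s / 1) (sym (card-unique unique))))
  where
  a l s M : ℕ
  -- Here `k - 1` is `suc κ`. Taking `a` positive makes the number of leaves `l = a * (k - 1) - 1`
  -- expressible without subtraction: `a * suc κ` computes to `suc l`. `s` is the same number in the
  -- form that `starPhase` expects, and the graph has `suc M` vertices.
  a = suc N
  l = κ + N ℕ.* suc κ
  s = vertices 1 l 0
  M = vertices (suc κ) a s

  coreBound : ℕ
  coreBound = vertices (suc κ) a 0

  G : Digraph (suc M)
  G = splitGraph coreBound (suc M)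

  R : List (Edge (suc M))
  R = contracted (suc κ) a (contracted 1 l [])

  s≡l : s ≡ l
  s≡l = trans (vertices≡ 1 l 0) (trans (+-identityʳ _) (*-identityʳ l))

  coreBound≡ : coreBound ≡ suc l
  coreBound≡ = trans (vertices≡ (suc κ) a 0) (+-identityʳ _)

  M≡ : M ≡ suc l + l
  M≡ = trans (vertices≡ (suc κ) a s) (cong (λ t → suc l + t) s≡l)

  isOPT : IsOPT G (suc M)
  isOPT = transport coreBound≡ M≡
    where
    -- Stated for variables, so that matching on `refl` replaces both indices at once in the
    -- dependent type.
    transport : ∀ {c r} → c ≡ suc l → r ≡ suc l + l → IsOPT (splitGraph c (suc r)) (suc r)
    transport refl refl = Hamiltonian.isOPT l

  unique : Unique R
  unique = contracted-unique κ a (contracted-unique 0 l [])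

  execution : Execution k (initial G) (map (relabel id) R)
  -- The `a` core cycles reduce the core to vertex 0, so the continuation starts from a star.
  execution = corePhase κ a (λ S → skipPhases κ S (starPhase l S)) initial-split

  N≤n : N ≤ suc M
  N≤n = begin
    N              ≤⟨ m≤m*n N (suc κ) ⟩
    N ℕ.* suc κ    ≤⟨ m≤n+m _ κ ⟩
    l              ≤⟨ m≤n+m l (suc l) ⟩
    suc l + l      ≡⟨ M≡ ⟨
    M              ≤⟨ n≤1+n M ⟩
    suc M          ∎
    where open ≤-Reasoning

  n≡ : suc M ≡ a ℕ.* (2 ℕ.* k ∸ 2)
  n≡ = trans (cong suc M≡) (identity κ N)
    where
    identity : ∀ κ N → suc (suc (κ + N ℕ.* suc κ) + (κ + N ℕ.* suc κ)) ≡ suc N ℕ.* (κ + (2 + (κ + 0)))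
    identity = solve-∀

  sum≡ : suc M + a ℕ.* k ≡ length R + 2
  sum≡ = trans (cong (λ M → suc M + a ℕ.* k) M≡) (trans (identity a k l) (cong (_+ 2) (sym length-R)))
    where
    identity : ∀ a k l → suc (suc l + l) + a ℕ.* k ≡ a ℕ.* k + (l ℕ.* 2 + 0) + 2
    identity = solve-∀

    length-R : length R ≡ a ℕ.* k + (l ℕ.* 2 + 0)
    length-R = trans (length-contracted (suc κ) a (contracted 1 l []))
                     (cong (λ t → a ℕ.* k + t) (length-contracted 1 l []))
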